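{- Let $n\geq 2$. There is a bijection between the set of core intervals in $\mathscr{D}_n$ and the set of pairs $([w,w'],i)$ where $[w,w']$ is an arbitrary interval in $\mathscr{D}_{n-2}$ and $i$ is an integer between $0$ and the number of blocks of $w$ (both included). The core interval corresponding to $([w,w'],i)$ is $[e_i(w),(1,w',1,0,0)]$.
   Context: A Dyck path of size $n\geq 0$ is a word of length $2n$ in the letters $0,1$ with $n$ letters $1$ and $n$ letters $0$ such that every prefix contains at least as many $1$'s as $0$'s (the height after a prefix is its number of $1$'s minus its number of $0$'s). Let $\mathscr{D}_n$ be the set of Dyck paths of size $n$. Every Dyck path is uniquely a concatenation of blocks, a block being a non-empty Dyck path whose height is $0$ only at its two ends (the empty path has $0$ blocks). A subpath of a Dyck path $w$ is a non-empty sequence $x$ of consecutive letters of $w$ that starts and ends at the same height and stays strictly above that height in between. A subpath $x$ is movable in $w$ if it is immediately preceded in $w$ by the letter $0$ and either $x$ ends at the last letter of $w$ or $x$ is immediately followed in $w$ by the letter $1$. For a movable subpath $x$, let $N=N(w,x)\geq 1$ be the number of consecutive letters $0$ just before $x$, so $w=a\,0^{N}\,x\,b$ where $a$ does not end with $0$; for $1\leq i\leq N$ let $M(w,x,i)=a\,0^{N-i}\,x\,0^{i}\,b\in\mathscr{D}_n$. Let $\Gamma_n$ be the directed graph on $\mathscr{D}_n$ with edges $w\to M(w,x,i)$ for all movable $x$ in $w$ and all $1\leq i\leq N(w,x)$. The dexter order is: $u\leq v$ if and only if there is a directed path (possibly of length $0$) from $u$ to $v$ in $\Gamma_n$. This is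 a partial order whose cover relations are exactly the edges of $\Gamma_n$. An interval $[u,v]$ is given by a pair $u\leq v$. A core interval in $\mathscr{D}_n$ is an interval whose minimum has the shape $(v,1,0)$ and whose maximum has the shape $(1,w,1,0,0)$, where $v$ and $w$ are Dyck paths. For $w\in\mathscr{D}_{n-2}$ with blocks $w=w_1w_2\cdots w_{m}$ ($m\geq 0$) and $0\leq i\leq m$, set $e_i(w)=(1,w_1,\dots,w_i,0,w_{i+1},\dots,w_m,1,0)\in\mathscr{D}_n$. -}

module Defs where

open import Data.Fin.Base using (Fin; toℕ)
open import Data.Fin.Patterns using (0F; 1F)
open import Data.Integer.Base as ℤ using (ℤ; 0ℤ; _⊖_)
import Data.Integer.Properties as ℤ
open import Data.List.Base using (List; []; _∷_; _++_; _∷ʳ_; concat; drop; length; replicate; take)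
open import Data.List.Properties using (++-identityʳ)
open import Data.List.Relation.Unary.All using (All; []; _∷_)
open import Data.Nat.Base using (ℕ; zero; suc; _+_; _∸_; _≤_; _<_; z≤n; s≤s; s≤s⁻¹)
open import Data.Nat.Properties
  using (_≟_; _≤?_; +-suc; ≤-reflexive; <⇒≢; ≤∧≢⇒<; suc-injective; m≤n⇒m≤1+n)
open import Data.Product.Base using (Σ; ∃-syntax; _×_; _,_; proj₁; proj₂)
open import Data.Sum.Base using (_⊎_; inj₁; inj₂)
open import Relation.Binary.Bundles using (Setoid)
open import Relation.Binary.Construct.Closure.ReflexiveTransitive using (Star)
import Relation.Binary.Construct.On as On
open import Relation.Binary.PropositionalEquality
  using (_≡_; _≢_; refl; sym; trans; cong; subst; setoid)
open import Relation.Nullary.Decidable using (recompute)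
open import Relation.Nullary.Negation using (contradiction)

Letter : Set
Letter = Fin 2

Word : Set
Word = List Letter

ones : Word → ℕ
ones []       = 0
ones (0F ∷ w) = ones w
ones (1F ∷ w) = suc (ones w)

zeros : Word → ℕ
zeros []       = 0
zeros (0F ∷ w) = suc (zeros w)
zeros (1F ∷ w) = zeros w

height : Word → ℤ
height w = ones w ⊖ zeros w

-- The length of w is 2n because every letter is 0 or 1.
record IsDyck (n : ℕ) (w : Word) : Set where
  field
    ones≡n  : ones w ≡ n
    zeros≡n : zeros w ≡ n
    prefix  : ∀ p s → w ≡ p ++ s → zeros p ≤ ones p

-- The proof is irrelevant, so that two Dyck paths are equal as soon as their
-- words are; `isDyck` recovers a relevant proof.
record DyckPath (n : ℕ) : Set where
  constructor mkDyckPath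
  field
    word     : Word
    .isDyck′ : IsDyck n word

open DyckPath public using (word)

isDyck : ∀ {n} (w : DyckPath n) → IsDyck n (word w)
isDyck {n} (mkDyckPath w d) = record
  { ones≡n  = recompute (ones w ≟ n) (IsDyck.ones≡n d)
  ; zeros≡n = recompute (zeros w ≟ n) (IsDyck.zeros≡n d)
  ; prefix  = λ p s eq → recompute (zeros p ≤? ones p) (IsDyck.prefix d p s eq)
  }

record IsBlock (b : Word) : Set where
  field
    nonEmpty : b ≢ []
    dyck     : ∃[ n ] IsDyck n b
    onlyEnds : ∀ p s → b ≡ p ++ s → height p ≡ 0ℤ → p ≡ [] ⊎ s ≡ []

prepend : Letter → List Word → List Word
prepend a []       = (a ∷ []) ∷ []
prepend a (b ∷ bs) = (a ∷ b) ∷ bs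

-- `cut h w` cuts w each time it comes down to height 0, h being the height at
-- which w starts.  The case of a letter 0 at height 0 is a junk value.
cut : ℕ → Word → List Word
cut h             []       = []
cut h             (1F ∷ w) = prepend 1F (cut (suc h) w)
cut zero          (0F ∷ w) = (0F ∷ []) ∷ cut 0 w
cut (suc zero)    (0F ∷ w) = (0F ∷ []) ∷ cut 0 w
cut (suc (suc h)) (0F ∷ w) = prepend 0F (cut (suc h) w)

-- The block decomposition of a Dyck path; `concat-blocks`, `blocks-isBlock` and
-- `blocks-unique` below show that it is one, and the only one.
blocks : Word → List Word
blocks = cut 0

numBlocks : Word → ℕ
numBlocks w = length (blocks w)

-- The occurrence of x in a ++ x ++ b is a subpath.
record IsSubpath (a x b : Word) : Set where
  field
    nonEmpty   : x ≢ []
    sameHeight : height (a ++ x) ≡ height a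
    above      : ∀ p s → x ≡ p ++ s → p ≢ [] → s ≢ [] → height a ℤ.< height (a ++ p)

-- The occurrence of x in a ++ x ++ b is a movable subpath.
record IsMovable (a x b : Word) : Set where
  field
    subpath  : IsSubpath a x b
    preceded : ∃[ c ] a ≡ c ∷ʳ 0F
    followed : b ≡ [] ⊎ ∃[ d ] b ≡ 1F ∷ d

infix 4 _⟶_ _≼_

-- The edges of Γₙ.
record _⟶_ {n : ℕ} (u v : DyckPath n) : Set where
  field
    a x b   : Word
    N i     : ℕ
    source  : word u ≡ a ++ replicate N 0F ++ x ++ b
    movable : IsMovable (a ++ replicate N 0F) x b
    maximal : ∀ c → a ≢ c ∷ʳ 0F
    1≤i     : 1 ≤ i
    i≤N     : i ≤ N
    target  : word v ≡ a ++ replicate (N ∸ i) 0F ++ x ++ replicate i 0F ++ b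

-- The dexter order.
_≼_ : ∀ {n} → DyckPath n → DyckPath n → Set
_≼_ = Star _⟶_

record Interval (n : ℕ) : Set where
  field
    min max : DyckPath n
    min≼max : min ≼ max

open Interval public using (min; max)

record IsCore {n : ℕ} (I : Interval n) : Set where
  field
    minShape : ∃[ v ] (∃[ k ] IsDyck k v) × word (min I) ≡ v ++ 1F ∷ 0F ∷ []
    maxShape : ∃[ w ] (∃[ k ] IsDyck k w) × word (max I) ≡ 1F ∷ w ++ 1F ∷ 0F ∷ 0F ∷ []

-- Since there may be several directed paths from u to v, intervals are compared
-- through their endpoints only.
endpoints : ∀ {n} → Interval n → DyckPath n × DyckPath n
endpoints I = min I , max I

CoreIntervals : ℕ → Setoid _ _
CoreIntervals n = On.setoid (setoid (DyckPath n × DyckPath n)) core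
  where
  core : Σ (Interval n) IsCore → DyckPath n × DyckPath n
  core (I , _) = endpoints I

IndexedInterval : ℕ → Set
IndexedInterval n = Σ (Interval n) λ I → Fin (suc (numBlocks (word (min I))))

IndexedIntervals : ℕ → Setoid _ _
IndexedIntervals n = On.setoid (setoid ((DyckPath n × DyckPath n) × ℕ)) indexed
  where
  indexed : IndexedInterval n → (DyckPath n × DyckPath n) × ℕ
  indexed (I , i) = endpoints I , toℕ i

-- For a Dyck path w, e i w is eᵢ(w); it is only used with i ≤ numBlocks w.
e : ℕ → Word → Word
e i w = 1F ∷ concat (take i (blocks w)) ++ 0F ∷ concat (drop i (blocks w)) ++ 1F ∷ 0F ∷ []

-- Correctness and uniqueness of the block decomposition.

concat-prepend : ∀ a bs → concat (prepend a bs) ≡ a ∷ concat bs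
concat-prepend a []       = refl
concat-prepend a (b ∷ bs) = refl

concat-cut : ∀ h w → concat (cut h w) ≡ w
concat-cut h             []       = refl
concat-cut h             (1F ∷ w) = trans (concat-prepend 1F (cut (suc h) w)) (cong (1F ∷_) (concat-cut (suc h) w))
concat-cut zero          (0F ∷ w) = cong (0F ∷_) (concat-cut 0 w)
concat-cut (suc zero)    (0F ∷ w) = cong (0F ∷_) (concat-cut 0 w)
concat-cut (suc (suc h)) (0F ∷ w) = trans (concat-prepend 0F (cut (suc h) w)) (cong (0F ∷_) (concat-cut (suc h) w))

concat-blocks : ∀ w → concat (blocks w) ≡ w
concat-blocks = concat-cut 0

-- Words going from height h to height 0 without becoming negative.
data Path : ℕ → Word → Set where
  []   : Path 0 []
  up   : ∀ {h w} → Path (suc h) w → Path h (1F ∷ w)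
  down : ∀ {h w} → Path h w → Path (suc h) (0F ∷ w)

-- Words going from height h to height 0 and reaching 0 only at the end.
data Descent : ℕ → Word → Set where
  stop : Descent 1 (0F ∷ [])
  up   : ∀ {h w} → Descent (suc (suc h)) w → Descent (suc h) (1F ∷ w)
  down : ∀ {h w} → Descent (suc h) w → Descent (suc (suc h)) (0F ∷ w)

toPath : ∀ h w → zeros w ≡ h + ones w →
         (∀ p s → w ≡ p ++ s → zeros p ≤ h + ones p) → Path h w
toPath zero    []       eq pre = []
toPath (suc h) []       () pre
toPath h       (1F ∷ w) eq pre = up (toPath (suc h) w (trans eq (+-suc h _))
  λ p s q → subst (zeros p ≤_) (+-suc h _) (pre (1F ∷ p) s (cong (1F ∷_) q)))
toPath zero    (0F ∷ w) eq pre with () ← pre (0F ∷ []) w refl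
toPath (suc h) (0F ∷ w) eq pre = down (toPath h w (suc-injective eq)
  λ p s q → s≤s⁻¹ (pre (0F ∷ p) s (cong (0F ∷_) q)))

toDescent : ∀ h w → zeros w ≡ suc h + ones w →
            (∀ p s → w ≡ p ++ s → s ≢ [] → zeros p < suc h + ones p) → Descent (suc h) w
toDescent h [] () pre
toDescent h (1F ∷ w) eq pre = up (toDescent (suc h) w (trans eq (cong suc (+-suc h _)))
  λ p s q s≢ → subst (zeros p <_) (cong suc (+-suc h _)) (pre (1F ∷ p) s (cong (1F ∷_) q) s≢))
toDescent zero (0F ∷ []) eq pre = stop
toDescent zero (0F ∷ a ∷ w) eq pre with s≤s () ← pre (0F ∷ []) (a ∷ w) refl (λ ())
toDescent (suc h) (0F ∷ w) eq pre = down (toDescent h w (suc-injective eq)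
  λ p s q s≢ → s≤s⁻¹ (pre (0F ∷ p) s (cong (0F ∷_) q) s≢))

descent-total : ∀ {h w} → Descent h w → zeros w ≡ h + ones w
descent-total stop             = refl
descent-total (up {h} d)       = trans (descent-total d) (cong suc (sym (+-suc h _)))
descent-total (down d)         = cong suc (descent-total d)

descent-prefix : ∀ {h w} → Descent h w → ∀ p s → w ≡ p ++ s → s ≢ [] → zeros p < h + ones p
descent-prefix stop       []       s eq s≢ = s≤s z≤n
descent-prefix stop       (0F ∷ []) s refl s≢ = contradiction refl s≢
descent-prefix (up d)     []       s eq s≢ = s≤s z≤n
descent-prefix (up {h} d) (1F ∷ p) s refl s≢ =
  subst (zeros p <_) (cong suc (sym (+-suc h _))) (descent-prefix d p s refl s≢)
descent-prefix (down d)   []       s eq s≢ = s≤s z≤n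
descent-prefix (down d)   (0F ∷ p) s refl s≢ = s≤s (descent-prefix d p s refl s≢)

⊖≡0⇒≡ : ∀ m n → m ⊖ n ≡ 0ℤ → m ≡ n
⊖≡0⇒≡ m n eq = ℤ.+-injective (ℤ.i-j≡0⇒i≡j (ℤ.+ m) (ℤ.+ n) (trans (ℤ.m-n≡m⊖n m n) eq))

descent⇒isBlock : ∀ {w} → Descent 1 w → IsBlock (1F ∷ w)
descent⇒isBlock {w} d = record
  { nonEmpty = λ ()
  ; dyck     = _ , record { ones≡n = refl ; zeros≡n = descent-total d ; prefix = prefix }
  ; onlyEnds = onlyEnds
  }
  where
  prefix : ∀ p s → 1F ∷ w ≡ p ++ s → zeros p ≤ ones p
  prefix []       s       eq   = z≤n
  prefix (1F ∷ p) (a ∷ s) refl = m≤n⇒m≤1+n (s≤s⁻¹ (descent-prefix d p (a ∷ s) refl λ ()))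
  prefix (1F ∷ p) []      refl rewrite ++-identityʳ p = ≤-reflexive (descent-total d)
  onlyEnds : ∀ p s → 1F ∷ w ≡ p ++ s → height p ≡ 0ℤ → p ≡ [] ⊎ s ≡ []
  onlyEnds []       s       eq   h = inj₁ refl
  onlyEnds (1F ∷ p) []      eq   h = inj₂ refl
  onlyEnds (1F ∷ p) (a ∷ s) refl h =
    contradiction (sym (⊖≡0⇒≡ (suc (ones p)) (zeros p) h))
                  (<⇒≢ (descent-prefix d p (a ∷ s) refl λ ()))

isBlock⇒descent : ∀ {b} → IsBlock b → ∃[ w ] b ≡ 1F ∷ w × Descent 1 w
isBlock⇒descent {[]} B = contradiction refl (IsBlock.nonEmpty B)
isBlock⇒descent {0F ∷ w} B with () ← IsDyck.prefix (proj₂ (IsBlock.dyck B)) (0F ∷ []) w refl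
isBlock⇒descent {1F ∷ w} B = w , refl , toDescent 0 w (trans D.zeros≡n (sym D.ones≡n)) pre
  where
  module D = IsDyck (proj₂ (IsBlock.dyck B))
  pre : ∀ p s → w ≡ p ++ s → s ≢ [] → zeros p < suc (ones p)
  pre p s refl s≢ = ≤∧≢⇒< (D.prefix (1F ∷ p) s refl) ne
    where
    ne : zeros p ≢ suc (ones p)
    ne eq with IsBlock.onlyEnds B (1F ∷ p) s refl
                 (trans (cong (suc (ones p) ⊖_) eq) (ℤ.n⊖n≡0 (suc (ones p))))
    ... | inj₂ s≡[] = s≢ s≡[]

cut-isBlock : ∀ {w} → Path 0 w → All IsBlock (cut 0 w)
cut-descent : ∀ {h w} → Path (suc h) w →
              ∃[ b ] ∃[ bs ] cut (suc h) w ≡ b ∷ bs × Descent (suc h) b × All IsBlock bs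
cut-isBlock [] = []
cut-isBlock (up {w = w} p) with cut 1 w | cut-descent p
... | _ | b , bs , refl , d , B = descent⇒isBlock d ∷ B
cut-descent (up {w = w} p) with cut-descent p
... | b , bs , eq , d , B = _ , bs , cong (prepend 1F) eq , up d , B
cut-descent {zero}  (down p) = _ , _ , refl , stop , cut-isBlock p
cut-descent {suc h} (down p) with cut-descent p
... | b , bs , eq , d , B = _ , bs , cong (prepend 0F) eq , down d , B

blocks-isBlock : ∀ {n w} → IsDyck n w → All IsBlock (blocks w)
blocks-isBlock {w = w} D = cut-isBlock (toPath 0 w (trans D.zeros≡n (sym D.ones≡n)) D.prefix)
  where module D = IsDyck D

cut-++ : ∀ {h b} → Descent h b → ∀ w → cut h (b ++ w) ≡ b ∷ cut 0 w
cut-++ stop     w = refl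
cut-++ (up d)   w = cong (prepend 1F) (cut-++ d w)
cut-++ (down d) w = cong (prepend 0F) (cut-++ d w)

blocks-unique : ∀ {bs} → All IsBlock bs → blocks (concat bs) ≡ bs
blocks-unique []                  = refl
blocks-unique {b ∷ bs} (B ∷ Bs) with isBlock⇒descent B
... | w , refl , d = trans (cong (prepend 1F) (cut-++ d (concat bs))) (cong ((1F ∷ w) ∷_) (blocks-unique Bs))

{-# OPTIONS --safe #-}

-- Deleting the first letter 1 and the first return to height 0 turns a Dyck
-- path (1, A, 0, B) into (A, B), and this deletion is order preserving: an edge
-- of Γ either descends to an edge or is contracted, the latter exactly when the
-- first block of B is moved inside the first block by one step.  Applied to a
-- core interval from (1, A, 0, B, 1, 0) to (1, w', 1, 0, 0) it gives
-- (A, B, 1, 0) ≤ (w', 1, 0).  As moving the last subpath of a word ending in 10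
-- creates a word ending in 00, and this cannot be undone, the final 10 may be
-- cancelled, whence (A, B) ≤ w'.  Conversely, eᵢ(w) climbs to (1, w, 1, 0, 0) by
-- moving its last blocks one after the other into the first one.
module Submission where

open import Defs
open import Data.Empty using (⊥)
open import Data.Fin.Base using (Fin; toℕ; fromℕ<)
open import Data.Fin.Patterns using (0F; 1F)
open import Data.Fin.Properties using (toℕ≤pred[n]; toℕ-fromℕ<)
open import Data.Integer.Base as ℤ using (0ℤ; _⊖_; +_)
import Data.Integer.Properties as ℤ
open import Algebra.Properties.CommutativeSemigroup ℤ.+-commutativeSemigroup using (interchange)
open import Algebra.Properties.AbelianGroup ℤ.+-0-abelianGroup using (identityʳ-unique)
open import Data.List.Base
  using (List; []; _∷_; _++_; _∷ʳ_; concat; drop; length; replicate; take; initLast; _∷ʳ′_)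
open import Data.List.Properties
  using (++-assoc; ++-cancelʳ; ++-identityʳ; concat-++; length-++; length-take; take++drop≡id;
         ∷-injective; ∷-injectiveʳ; ∷ʳ-injective)
open import Data.List.Relation.Unary.All using (All; []; _∷_)
import Data.List.Relation.Unary.All.Properties as All
open import Data.Nat.Base using (ℕ; zero; suc; _≤_; _<_; _∸_; _+_; z≤n; s≤s; s<s; s<s⁻¹)
open import Data.Nat.Properties
  using (+-suc; <⇒≤; ≤-reflexive; ≤∧≢⇒<; <-irrefl; m≤m+n; suc-injective; m≤n⇒m⊓n≡m)
open import Data.Product.Base using (Σ; ∃-syntax; _×_; _,_; proj₁; proj₂)
open import Data.Sum.Base using (_⊎_; inj₁; inj₂)
open import Function.Base using (_∘_)
open import Function.Bundles using (Bijection)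
open import Relation.Binary.Construct.Closure.ReflexiveTransitive using (Star; ε; _◅_; _◅◅_; gmap)
open import Relation.Binary.PropositionalEquality
  using (_≡_; _≢_; refl; sym; trans; cong; cong₂; subst; subst₂; module ≡-Reasoning)
open import Relation.Nullary.Negation using (¬_; contradiction)

-- Factorizations of words

levi : ∀ {A : Set} (p q : List A) {r s} → p ++ r ≡ q ++ s →
       (∃[ t ] p ≡ q ++ t × s ≡ t ++ r) ⊎ (∃[ t ] q ≡ p ++ t × r ≡ t ++ s)
levi p       []      eq = inj₁ (p , refl , sym eq)
levi []      (b ∷ q) eq = inj₂ (b ∷ q , refl , eq)
levi (a ∷ p) (b ∷ q) eq with ∷-injective eq
... | refl , eq′ with levi p q eq′
...   | inj₁ (t , e₁ , e₂) = inj₁ (t , cong (a ∷_) e₁ , e₂)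
...   | inj₂ (t , e₁ , e₂) = inj₂ (t , cong (a ∷_) e₁ , e₂)

++-assoc₃ : ∀ {A : Set} (a b c d : List A) → (a ++ b ++ c) ++ d ≡ a ++ b ++ c ++ d
++-assoc₃ a b c d = trans (++-assoc a (b ++ c) d) (cong (a ++_) (++-assoc b c d))

++-assoc₄ : ∀ {A : Set} (a b c d e : List A) → (a ++ b ++ c ++ d) ++ e ≡ a ++ b ++ c ++ d ++ e
++-assoc₄ a b c d e = trans (++-assoc a (b ++ c ++ d) e) (cong (a ++_) (++-assoc₃ b c d e))

++-assoc₅ : ∀ {A : Set} (a b c d e f : List A) →
            (a ++ b ++ c ++ d ++ e) ++ f ≡ a ++ b ++ c ++ d ++ e ++ f
++-assoc₅ a b c d e f = trans (++-assoc a (b ++ c ++ d ++ e) f) (cong (a ++_) (++-assoc₄ b c d e f))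

-- Zeros, ones and heights

infix 30 0^_

0^_ : ℕ → Word
0^ k = replicate k 0F

0^-∷ʳ : ∀ k s → 0^ k ++ 0F ∷ s ≡ 0F ∷ 0^ k ++ s
0^-∷ʳ zero    s = refl
0^-∷ʳ (suc k) s = cong (0F ∷_) (0^-∷ʳ k s)

0^-∸ : ∀ {i N} → i ≤ N → ∀ s → 0^ N ++ s ≡ 0^ (N ∸ i) ++ 0^ i ++ s
0^-∸ z≤n s = refl
0^-∸ {suc i} {suc N} (s≤s le) s =
  trans (cong (0F ∷_) (0^-∸ le s)) (sym (0^-∷ʳ (N ∸ i) (0^ i ++ s)))

ones-++ : ∀ u v → ones (u ++ v) ≡ ones u + ones v
ones-++ []       v = refl
ones-++ (0F ∷ u) v = ones-++ u v
ones-++ (1F ∷ u) v = cong suc (ones-++ u v)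

zeros-++ : ∀ u v → zeros (u ++ v) ≡ zeros u + zeros v
zeros-++ []       v = refl
zeros-++ (0F ∷ u) v = cong suc (zeros-++ u v)
zeros-++ (1F ∷ u) v = zeros-++ u v

ones-0^ : ∀ k v → ones (0^ k ++ v) ≡ ones v
ones-0^ zero    v = refl
ones-0^ (suc k) v = ones-0^ k v

height-++ : ∀ u v → height (u ++ v) ≡ height u ℤ.+ height v
height-++ u v = begin
  ones (u ++ v) ⊖ zeros (u ++ v)
    ≡⟨ cong₂ _⊖_ (ones-++ u v) (zeros-++ u v) ⟩
  (ones u + ones v) ⊖ (zeros u + zeros v)
    ≡⟨ ℤ.m-n≡m⊖n (ones u + ones v) (zeros u + zeros v) ⟨
  (+ ones u ℤ.+ + ones v) ℤ.- (+ zeros u ℤ.+ + zeros v)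
    ≡⟨ cong (ℤ._+_ (+ ones u ℤ.+ + ones v)) (ℤ.neg-distrib-+ (+ zeros u) (+ zeros v)) ⟩
  (+ ones u ℤ.+ + ones v) ℤ.+ (ℤ.- + zeros u ℤ.+ ℤ.- + zeros v)
    ≡⟨ interchange (+ ones u) (+ ones v) (ℤ.- + zeros u) (ℤ.- + zeros v) ⟩
  (+ ones u ℤ.- + zeros u) ℤ.+ (+ ones v ℤ.- + zeros v)
    ≡⟨ cong₂ ℤ._+_ (ℤ.m-n≡m⊖n (ones u) (zeros u)) (ℤ.m-n≡m⊖n (ones v) (zeros v)) ⟩
  height u ℤ.+ height v ∎
  where open ≡-Reasoning

0<⊖⇒> : ∀ m n → 0ℤ ℤ.< m ⊖ n → n < m
0<⊖⇒> zero    zero    (ℤ.+<+ ())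
0<⊖⇒> zero    (suc n) ()
0<⊖⇒> (suc m) zero    lt = s≤s z≤n
0<⊖⇒> (suc m) (suc n) lt = s<s (0<⊖⇒> m n (subst (0ℤ ℤ.<_) (ℤ.[1+m]⊖[1+n]≡m⊖n m n) lt))

>⇒0<⊖ : ∀ m n → n < m → 0ℤ ℤ.< m ⊖ n
>⇒0<⊖ (suc m) zero    lt = ℤ.+<+ (s≤s z≤n)
>⇒0<⊖ (suc m) (suc n) lt = subst (0ℤ ℤ.<_) (sym (ℤ.[1+m]⊖[1+n]≡m⊖n m n)) (>⇒0<⊖ m n (s<s⁻¹ lt))

-- Paths

path-zeros : ∀ {h w} → Path h w → zeros w ≡ h + ones w
path-zeros []               = refl
path-zeros (up {h} {w} p)   = trans (path-zeros p) (sym (+-suc h (ones w)))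
path-zeros (down p)         = cong suc (path-zeros p)

path-prefix : ∀ {h w} → Path h w → ∀ p s → w ≡ p ++ s → zeros p ≤ h + ones p
path-prefix d        []       s eq   = z≤n
path-prefix (up {h} d)   (1F ∷ p) s refl =
  subst (zeros p ≤_) (sym (+-suc h (ones p))) (path-prefix d p s refl)
path-prefix (down d) (0F ∷ p) s refl = s≤s (path-prefix d p s refl)

path⇒isDyck : ∀ {w} → Path 0 w → IsDyck (ones w) w
path⇒isDyck d = record { ones≡n = refl ; zeros≡n = path-zeros d ; prefix = path-prefix d }

isDyck⇒path : ∀ {n w} → IsDyck n w → Path 0 w
isDyck⇒path D = toPath 0 _ (trans D.zeros≡n (sym D.ones≡n)) D.prefix
  where module D = IsDyck D

path-++ : ∀ {h k u v} → Path h u → Path k v → Path (h + k) (u ++ v)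
path-++ []       q = q
path-++ (up p)   q = up (path-++ p q)
path-++ (down p) q = down (path-++ p q)

path-drop : ∀ {h k u v} → Path h u → Path (h + k) (u ++ v) → Path k v
path-drop []       q        = q
path-drop (up p)   (up q)   = path-drop p q
path-drop (down p) (down q) = path-drop p q

path-suffix : ∀ {h} u {v} → Path h (u ++ v) → ∃[ k ] Path k v
path-suffix []      p        = _ , p
path-suffix (_ ∷ u) (up p)   = path-suffix u p
path-suffix (_ ∷ u) (down p) = path-suffix u p

-- The height reached after `a` is not tracked, so the replacement of `s` by `t` has to be valid
-- from every height k.
path-context : ∀ a {h s t} → (∀ {k} → Path k s → Path k t) → Path h (a ++ s) → Path h (a ++ t)
path-context []      f p        = f p
path-context (_ ∷ a) f (up p)   = up (path-context a f p)
path-context (_ ∷ a) f (down p) = down (path-context a f p)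

-- Seen from one level higher, `Path h u` says that `w` stays at height at least 1 along `u` and
-- ends it at height 1, so the displayed 0 is the first arrival at height 0.
path-first-return : ∀ {h w} → Path (suc h) w → ∃[ u ] ∃[ v ] w ≡ u ++ 0F ∷ v × Path h u × Path 0 v
path-first-return {h} (up p) with path-first-return p
... | u , v , refl , q , r = 1F ∷ u , v , refl , up q , r
path-first-return {zero}  (down {w = w} p) = [] , w , refl , [] , p
path-first-return {suc h} (down p) with path-first-return p
... | u , v , refl , q , r = 0F ∷ u , v , refl , down q , r

-- If one of `u`, `u′` were a proper prefix of the other, the longer one would read a letter 0 at
-- height 0.
first-return-unique : ∀ {h u u′ v v′} → Path h u → Path h u′ →
                      u ++ 0F ∷ v ≡ u′ ++ 0F ∷ v′ → u ≡ u′ × v ≡ v′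
first-return-unique []       []        eq = refl , ∷-injectiveʳ eq
first-return-unique (up p)   (up p′)   eq with first-return-unique p p′ (∷-injectiveʳ eq)
... | refl , refl = refl , refl
first-return-unique (down p) (down p′) eq with first-return-unique p p′ (∷-injectiveʳ eq)
... | refl , refl = refl , refl

-- The net descent along `u` is m, which leaves the second path at height h - m; reading 0 there
-- requires this to be positive.
path-overrun : ∀ {m h} u {v} → Path m u → Path h (u ++ 0F ∷ v) → m < h
path-overrun []       []       (down q) = s≤s z≤n
path-overrun (_ ∷ u)  (up p)   (up q)   = s<s⁻¹ (path-overrun u p q)
path-overrun (_ ∷ u)  (down p) (down q) = s<s (path-overrun u p q)

-- Blocks and subpaths

block-path : ∀ {x} → IsBlock x → Path 0 x
block-path B = isDyck⇒path (proj₂ (IsBlock.dyck B))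

block-head : ∀ {x} → IsBlock x → ∃[ y ] x ≡ 1F ∷ y
block-head B with isBlock⇒descent B
... | y , eq , _ = y , eq

descent-last : ∀ {h w} → Descent h w → ∃[ y ] w ≡ y ∷ʳ 0F
descent-last stop = [] , refl
descent-last (up d) with descent-last d
... | y , refl = 1F ∷ y , refl
descent-last (down d) with descent-last d
... | y , refl = 0F ∷ y , refl

block-last : ∀ {x} → IsBlock x → ∃[ y ] x ≡ y ∷ʳ 0F
block-last B with isBlock⇒descent B
... | _ , refl , d with descent-last d
...   | y , refl = 1F ∷ y , refl

blocks-path : ∀ {bs} → All IsBlock bs → Path 0 (concat bs)
blocks-path []       = []
blocks-path (B ∷ Bs) = path-++ (block-path B) (blocks-path Bs)

10-isBlock : IsBlock (1F ∷ 0F ∷ [])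
10-isBlock = descent⇒isBlock stop

-- Heights are additive under concatenation, so subtracting the height of `a` turns the conditions
-- on `a ++ p` into conditions on `p` alone.
subpath⇒block : ∀ {a x b} → IsSubpath a x b → IsBlock x
subpath⇒block {a} {x} S = record
  { nonEmpty = S.nonEmpty
  ; dyck     = ones x , record { ones≡n = refl ; zeros≡n = sym balanced ; prefix = prefix }
  ; onlyEnds = onlyEnds
  }
  where
  module S = IsSubpath S
  balanced : ones x ≡ zeros x
  balanced = ⊖≡0⇒≡ _ _ (identityʳ-unique (height a) (height x) (trans (sym (height-++ a x)) S.sameHeight))
  positive : ∀ p s → x ≡ p ++ s → p ≢ [] → s ≢ [] → zeros p < ones p
  positive p s eq p≢ s≢ = 0<⊖⇒> _ _ (ℤ.≰⇒> λ h≤0 →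
    ℤ.<⇒≱ (S.above p s eq p≢ s≢)
      (subst₂ ℤ._≤_ (sym (height-++ a p)) (ℤ.+-identityʳ (height a)) (ℤ.+-monoʳ-≤ (height a) h≤0)))
  prefix : ∀ p s → x ≡ p ++ s → zeros p ≤ ones p
  prefix []      s       eq   = z≤n
  prefix (c ∷ p) []      eq   =
    subst (λ w → zeros w ≤ ones w) (trans eq (++-identityʳ (c ∷ p))) (≤-reflexive (sym balanced))
  prefix (c ∷ p) (d ∷ s) eq   = <⇒≤ (positive (c ∷ p) (d ∷ s) eq (λ ()) (λ ()))
  onlyEnds : ∀ p s → x ≡ p ++ s → height p ≡ 0ℤ → p ≡ [] ⊎ s ≡ []
  onlyEnds []      s       eq h = inj₁ refl
  onlyEnds (c ∷ p) []      eq h = inj₂ refl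
  onlyEnds (c ∷ p) (d ∷ s) eq h =
    contradiction (positive (c ∷ p) (d ∷ s) eq (λ ()) (λ ())) (<-irrefl (sym (⊖≡0⇒≡ _ _ h)))

block⇒subpath : ∀ {a x b} → IsBlock x → IsSubpath a x b
block⇒subpath {a} {x} B = record
  { nonEmpty   = B.nonEmpty
  ; sameHeight = trans (height-++ a x) (trans (cong (ℤ._+_ (height a)) balanced) (ℤ.+-identityʳ (height a)))
  ; above      = above
  }
  where
  module B = IsBlock B
  module D = IsDyck (proj₂ B.dyck)
  balanced : height x ≡ 0ℤ
  balanced = trans (cong₂ _⊖_ D.ones≡n D.zeros≡n) (ℤ.n⊖n≡0 (proj₁ B.dyck))
  above : ∀ p s → x ≡ p ++ s → p ≢ [] → s ≢ [] → height a ℤ.< height (a ++ p)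
  above p s eq p≢ s≢ = subst₂ ℤ._<_ (ℤ.+-identityʳ (height a)) (sym (height-++ a p))
    (ℤ.+-monoʳ-< (height a) (>⇒0<⊖ (ones p) (zeros p) (≤∧≢⇒< (D.prefix p s eq) λ zeros≡ones →
      case-ends (B.onlyEnds p s eq (trans (cong (ones p ⊖_) zeros≡ones) (ℤ.n⊖n≡0 (ones p)))))))
    where
    case-ends : p ≡ [] ⊎ s ≡ [] → ⊥
    case-ends (inj₁ p≡) = p≢ p≡
    case-ends (inj₂ s≡) = s≢ s≡

-- The edges of Γ on the level of words

Follows : Word → Set
Follows b = b ≡ [] ⊎ ∃[ d ] b ≡ 1F ∷ d

NoTrailing0 : Word → Set
NoTrailing0 a = ∀ c → a ≢ c ∷ʳ 0F

infix 4 _⇝_ _⇝*_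

-- Edges stripped of the Dyck condition and of the size, so that prefixes and suffixes can be
-- removed or attached. The 0 that must precede `x` is provided by 1 ≤ i ≤ N.
data _⇝_ : Word → Word → Set where
  move : ∀ a {x b N i} → IsBlock x → Follows b → NoTrailing0 a → 1 ≤ i → i ≤ N →
         a ++ 0^ N ++ x ++ b ⇝ a ++ 0^ (N ∸ i) ++ x ++ 0^ i ++ b

_⇝*_ : Word → Word → Set
_⇝*_ = Star _⇝_

⟶⇒⇝ : ∀ {n} {u v : DyckPath n} → u ⟶ v → word u ⇝ word v
⟶⇒⇝ E = subst₂ _⇝_ (sym source) (sym target)
  (move a (subpath⇒block (IsMovable.subpath movable)) (IsMovable.followed movable) maximal 1≤i i≤N)
  where open _⟶_ E

⇝⇒⟶ : ∀ {n} {u v : DyckPath n} → word u ⇝ word v → u ⟶ v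
⇝⇒⟶ {u = u} {v} m = go m refl refl
  where
  preceded : ∀ a k → ∃[ c ] a ++ 0^ suc k ≡ c ∷ʳ 0F
  preceded a k = a ++ 0^ k , sym (trans (++-assoc a (0^ k) (0F ∷ []))
    (cong (a ++_) (trans (0^-∷ʳ k []) (cong (0F ∷_) (++-identityʳ (0^ k))))))
  go : ∀ {u′ v′} → u′ ⇝ v′ → word u ≡ u′ → word v ≡ v′ → u ⟶ v
  go (move a {x} {b} {suc N} {suc i} B F M 1≤i i≤N) src tgt = record
    { a = a ; x = x ; b = b ; N = suc N ; i = suc i
    ; source = src
    ; movable = record { subpath = block⇒subpath {b = b} B ; preceded = preceded a N ; followed = F }
    ; maximal = M ; 1≤i = 1≤i ; i≤N = i≤N
    ; target = tgt
    }

-- The balanced word `x` is lifted by i levels, and the heights from `b` onwards do not change.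
path-shift : ∀ {h x b} → Path 0 x → ∀ i → Path h (0^ i ++ x ++ b) → Path h (x ++ 0^ i ++ b)
path-shift X i p = path-++ X (path-context (0^ i) (path-drop X) p)

path-move : ∀ a {h x b i N} → Path 0 x → i ≤ N →
            Path h (a ++ 0^ N ++ x ++ b) → Path h (a ++ 0^ (N ∸ i) ++ x ++ 0^ i ++ b)
path-move a {i = i} {N} X i≤N = path-context a λ p →
  path-context (0^ (N ∸ i)) (path-shift X i) (subst (Path _) (0^-∸ i≤N _) p)

ones-move : ∀ a {x b} i j k → ones (a ++ 0^ i ++ x ++ b) ≡ ones (a ++ 0^ j ++ x ++ 0^ k ++ b)
ones-move a {x} {b} i j k
  rewrite ones-++ a (0^ i ++ x ++ b) | ones-0^ i (x ++ b) | ones-++ x b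
        | ones-++ a (0^ j ++ x ++ 0^ k ++ b) | ones-0^ j (x ++ 0^ k ++ b)
        | ones-++ x (0^ k ++ b) | ones-0^ k b = refl

⇝-isDyck : ∀ {n u v} → u ⇝ v → IsDyck n u → IsDyck n v
⇝-isDyck (move a {x} {b} {N} {i} B F M 1≤i i≤N) D =
  subst (λ n → IsDyck n _) (trans (sym (ones-move a {x} {b} N (N ∸ i) i)) (IsDyck.ones≡n D))
    (path⇒isDyck (path-move a {x = x} {b} (block-path B) i≤N (isDyck⇒path D)))

≼⇒⇝* : ∀ {n} {u v : DyckPath n} → u ≼ v → word u ⇝* word v
≼⇒⇝* = gmap word ⟶⇒⇝

word-injective : ∀ {n} {u v : DyckPath n} → word u ≡ word v → u ≡ v
word-injective refl = refl

-- Only the two ends are given as Dyck paths. The vertices between them are Dyck paths because moves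
-- preserve this.
⇝*⇒≼ : ∀ {n} {u v : DyckPath n} → word u ⇝* word v → u ≼ v
⇝*⇒≼ {n} {u} {v} ms = go u ms refl refl
  where
  go : ∀ u {w w′} → w ⇝* w′ → word u ≡ w → w′ ≡ word v → u ≼ v
  go u ε        refl refl = ε
  go u (_◅_ {j = w} m ms) refl eq =
    ⇝⇒⟶ m ◅ go (mkDyckPath w (⇝-isDyck m (isDyck u))) ms refl eq

-- Removing the first return

-- The image of an edge that starts at (1, A, 0, B). It is a directed path and not an edge, to allow
-- for contraction.
RemovedStep : Word → Word → Word → Set
RemovedStep A B v = ∃[ A′ ] ∃[ B′ ]
  v ≡ 1F ∷ A′ ++ 0F ∷ B′ × Path 0 A′ × Path 0 B′ × A ++ B ⇝* A′ ++ B′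

noTrailing0-suffix : ∀ a {s} → NoTrailing0 (a ++ s) → NoTrailing0 s
noTrailing0-suffix a M c refl = M (a ++ c) (sym (++-assoc a c (0F ∷ [])))

noTrailing0-extend : ∀ a {s} → s ≢ [] → NoTrailing0 s → NoTrailing0 (a ++ s)
noTrailing0-extend a {s} s≢ M c eq with initLast s
... | []      = s≢ refl
... | s′ ∷ʳ′ z with ∷ʳ-injective (a ++ s′) c (trans (++-assoc a s′ (z ∷ [])) eq)
...   | _ , refl = M s′ refl

-- Here `x` and the letter 1 after it lie before the first return, so the same move takes place
-- inside A. The prefix `a` contains at least the opening 1, as the run of zeros cannot open the
-- word.
step-inside-first : ∀ a {A B x t N i} → IsBlock x → NoTrailing0 a → 1 ≤ i → i ≤ N →
  Path 0 A → Path 0 B →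
  1F ∷ A ≡ a ++ 0^ N ++ x ++ 1F ∷ t →
  RemovedStep A B (a ++ 0^ (N ∸ i) ++ x ++ 0^ i ++ 1F ∷ t ++ 0F ∷ B)
step-inside-first [] X M (s≤s _) (s≤s _) PA PB ()
step-inside-first (1F ∷ a) {A} {B} {x} {t} {N} {i} X M 1≤i i≤N PA PB refl =
  a ++ 0^ (N ∸ i) ++ x ++ 0^ i ++ 1F ∷ t , B
  , cong (1F ∷_) (sym (++-assoc₅ a (0^ (N ∸ i)) x (0^ i) (1F ∷ t) (0F ∷ B)))
  , path-move a (block-path X) i≤N PA , PB
  , subst₂ _⇝_ (sym (++-assoc₄ a (0^ N) x (1F ∷ t) B))
      (sym (++-assoc₅ a (0^ (N ∸ i)) x (0^ i) (1F ∷ t) B))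
      (move a X (inj₂ (t ++ B , refl)) (noTrailing0-suffix (1F ∷ []) M) 1≤i i≤N) ◅ ε

-- Here the whole run of zeros lies behind the first return, so the move takes place inside B. The
-- word `s` between them is non-empty, since the return would otherwise belong to the run.
step-beyond-first : ∀ s {A x b N i} → IsBlock x → Follows b → NoTrailing0 (1F ∷ A ++ 0F ∷ s) →
  1 ≤ i → i ≤ N → Path 0 A → Path 0 (s ++ 0^ N ++ x ++ b) →
  RemovedStep A (s ++ 0^ N ++ x ++ b) (1F ∷ A ++ 0F ∷ s ++ 0^ (N ∸ i) ++ x ++ 0^ i ++ b)
step-beyond-first [] {A} X F M _ _ PA PB = contradiction refl (M (1F ∷ A))
step-beyond-first s@(_ ∷ _) {A} {x} {b} {N} {i} X F M 1≤i i≤N PA PB =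
  A , s ++ 0^ (N ∸ i) ++ x ++ 0^ i ++ b , refl , PA , path-move s (block-path X) i≤N PB
  , subst₂ _⇝_ (++-assoc A s _) (++-assoc A s _)
      (move (A ++ s) X F
        (noTrailing0-extend A (λ ()) (noTrailing0-suffix (0F ∷ []) (noTrailing0-suffix (1F ∷ A) M)))
        1≤i i≤N) ◅ ε

-- Here the first return is the last zero of the run; N and i do not count it. The move draws `x`
-- into the first block, and the last of the moved zeros becomes the new first return. Its removal
-- leaves a move of `x` over i zeros, which is an edge if i is positive and a contraction if i = 0.
step-across-return : ∀ a {A x b N i} → IsBlock x → Follows b → NoTrailing0 a →
  i ≤ N → Path 0 A → Path 0 (x ++ b) → 1F ∷ A ≡ a ++ 0^ N →
  RemovedStep A (x ++ b) (a ++ 0^ (N ∸ i) ++ x ++ 0F ∷ 0^ i ++ b)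
step-across-return [] {N = zero}  X F M i≤N PA PB ()
step-across-return [] {N = suc N} X F M i≤N PA PB ()
step-across-return (1F ∷ a) {x = x} {b} {N} {i} X F M i≤N PA PB refl =
  a ++ 0^ (N ∸ i) ++ x ++ 0^ i , b
  , cong (1F ∷_) (trans (cong (λ z → a ++ 0^ (N ∸ i) ++ x ++ z) (sym (0^-∷ʳ i b)))
      (sym (++-assoc₄ a (0^ (N ∸ i)) x (0^ i) (0F ∷ b))))
  -- The new first part arises by appending the balanced `x` to A and then moving it back over i
  -- zeros.
  , subst (Path 0) (cong (λ z → a ++ 0^ (N ∸ i) ++ x ++ z) (++-identityʳ (0^ i)))
      (path-move a PX i≤N (path-context a (path-context (0^ N) (path-++ PX))
        (subst (λ z → Path 0 (a ++ z)) (sym (++-identityʳ (0^ N))) PA)))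
  , path-drop PX PB
  , steps i≤N
  where
  PX = block-path X
  steps : ∀ {i} → i ≤ N → (a ++ 0^ N) ++ x ++ b ⇝* (a ++ 0^ (N ∸ i) ++ x ++ 0^ i) ++ b
  steps {zero}  _   = subst ((a ++ 0^ N) ++ x ++ b ⇝*_)
    (trans (++-assoc a (0^ N) (x ++ b)) (sym (++-assoc₄ a (0^ N) x [] b))) ε
  steps {suc i} i≤N = subst₂ _⇝_ (sym (++-assoc a (0^ N) (x ++ b)))
    (sym (++-assoc₄ a (0^ (N ∸ suc i)) x (0^ suc i) b))
    (move a X F (noTrailing0-suffix (1F ∷ []) M) (s≤s z≤n) i≤N) ◅ ε

suffix-of-zeros : ∀ s {t N y} → 0^ N ≡ s ++ t → Path 0 (t ++ y) → t ≡ []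
suffix-of-zeros []      {N = zero}  refl p  = refl
suffix-of-zeros []      {N = suc N} refl ()
suffix-of-zeros (_ ∷ s) {N = suc N} eq   p  = suffix-of-zeros s (∷-injectiveʳ eq) p

-- A block t ++ 0F ∷ s overlapping the first return would come down below its
-- starting height.
no-block-across-return : ∀ a {A t s N i} → 1 ≤ i → i ≤ N → Path 0 A →
  1F ∷ A ≡ (a ++ 0^ N) ++ t → ¬ Path 0 (t ++ 0F ∷ s)
no-block-across-return []           (s≤s _) (s≤s _) PA ()
no-block-across-return (1F ∷ a) {t = t} {N = N} _ _ PA refl q
  with _ , p ← path-suffix (a ++ 0^ N) PA with () ← path-overrun t p q

-- The cases locate the first return relative to `a`, the run of zeros, `x` and `b`.
removed-step : ∀ {A B w v} → Path 0 A → Path 0 B →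
  w ≡ 1F ∷ A ++ 0F ∷ B → w ⇝ v → RemovedStep A B v
removed-step {A} {B} PA PB eq (move a {x} {b} {N} {i} X F M 1≤i i≤N)
  with levi (1F ∷ A) (a ++ 0^ N) (trans (sym eq) (sym (++-assoc a (0^ N) (x ++ b))))
... | inj₁ (t , e₁ , e₂) = inFirst (levi t x (sym e₂)) F
  where
  inFirst : (∃[ s ] t ≡ x ++ s × b ≡ s ++ 0F ∷ B) ⊎ (∃[ s ] x ≡ t ++ s × 0F ∷ B ≡ s ++ b) →
            Follows b → RemovedStep A B (a ++ 0^ (N ∸ i) ++ x ++ 0^ i ++ b)
  inFirst (inj₁ (1F ∷ s , refl , refl)) _ = step-inside-first a X M 1≤i i≤N PA PB
    (trans e₁ (++-assoc a (0^ N) (x ++ 1F ∷ s)))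
  -- In this and the next five cases `b` begins with 0, either the return itself or a letter of A,
  -- so `x` is not movable.
  inFirst (inj₁ ([]     , refl , refl)) (inj₁ ())
  inFirst (inj₁ ([]     , refl , refl)) (inj₂ ())
  inFirst (inj₁ (0F ∷ s , refl , refl)) (inj₁ ())
  inFirst (inj₁ (0F ∷ s , refl , refl)) (inj₂ ())
  inFirst (inj₂ ([]     , refl , refl)) (inj₁ ())
  inFirst (inj₂ ([]     , refl , refl)) (inj₂ ())
  inFirst (inj₂ (0F ∷ s , refl , _)) _
    = contradiction (block-path X) (no-block-across-return a 1≤i i≤N PA e₁)
... | inj₂ (t , e₁ , e₂) = beyond t e₁ e₂
  where
  beyond : ∀ t → a ++ 0^ N ≡ (1F ∷ A) ++ t → 0F ∷ B ≡ t ++ x ++ b →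
           RemovedStep A B (a ++ 0^ (N ∸ i) ++ x ++ 0^ i ++ b)
  beyond []       _  e₂ with y , refl ← block-head X with () ← e₂
  beyond (0F ∷ t) e₁ refl
    with levi a (1F ∷ A ++ 0F ∷ []) (trans e₁ (sym (++-assoc (1F ∷ A) (0F ∷ []) t)))
  ... | inj₁ (s , refl , refl) =
    subst₂ (λ B → RemovedStep A B) (sym (++-assoc s (0^ N) (x ++ b)))
      (sym (trans (++-assoc (1F ∷ A ++ 0F ∷ []) s _) (++-assoc (1F ∷ A) (0F ∷ []) _)))
      (step-beyond-first s X F (subst NoTrailing0 (++-assoc (1F ∷ A) (0F ∷ []) s) M) 1≤i i≤N PA
        (subst (Path 0) (++-assoc s (0^ N) (x ++ b)) PB))
  -- Zeros of the run behind the return would open B, which starts at height 0. Hence the return is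
  -- the last zero of the run.
  ... | inj₂ (s , e₃ , e₄) with refl ← suffix-of-zeros s e₄ PB
    = across 1≤i i≤N (trans e₃ (cong (a ++_) (trans (sym (++-identityʳ s)) (sym e₄))))
    where
    across : ∀ {i N} → 1 ≤ i → i ≤ N → 1F ∷ A ++ 0F ∷ [] ≡ a ++ 0^ N →
             RemovedStep A (x ++ b) (a ++ 0^ (N ∸ i) ++ x ++ 0^ i ++ b)
    -- Stripping the successors takes the return out of both the run and its moved part.
    across {N = suc N} (s≤s _) (s≤s i≤N) eq = step-across-return a X F M i≤N PA PB
      (proj₁ (∷ʳ-injective (1F ∷ A) (a ++ 0^ N) (trans eq
        (trans (cong (a ++_) (trans (cong (0F ∷_) (sym (++-identityʳ (0^ N)))) (sym (0^-∷ʳ N []))))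
               (sym (++-assoc a (0^ N) (0F ∷ [])))))))

removed-steps : ∀ {A B v w} → Path 0 A → Path 0 B →
  w ≡ 1F ∷ A ++ 0F ∷ B → w ⇝* v → RemovedStep A B v
removed-steps {A} {B} PA PB eq ε = A , B , eq , PA , PB , ε
removed-steps PA PB eq (m ◅ ms) with removed-step PA PB eq m
... | A′ , B′ , eq′ , PA′ , PB′ , ns with removed-steps PA′ PB′ eq′ ms
...   | A″ , B″ , eq″ , PA″ , PB″ , ns′ = A″ , B″ , eq″ , PA″ , PB″ , ns ◅◅ ns′

-- Cancelling a final 10

-- The only 1 in the final `10` is its first letter, so a 1 that follows `y` cannot lie strictly
-- inside that ending.
ends10-++ : ∀ (p y : Word) {d} → p ++ 1F ∷ 0F ∷ [] ≡ y ++ 1F ∷ d →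
            ∃[ t ] 1F ∷ d ≡ t ++ 1F ∷ 0F ∷ [] × p ≡ y ++ t
ends10-++ p y eq with levi p y eq
... | inj₁ (t , e₁ , e₂) = t , e₂ , e₁
... | inj₂ ([] , e₁ , e₂) = [] , sym e₂ , trans (sym (trans e₁ (++-identityʳ p))) (sym (++-identityʳ y))
... | inj₂ (_ ∷ [] , e₁ , ())
... | inj₂ (_ ∷ _ ∷ [] , e₁ , ())
... | inj₂ (_ ∷ _ ∷ _ ∷ _ , e₁ , ())

ends00-++ : ∀ (r y : Word) {d} → r ++ 0F ∷ 0F ∷ [] ≡ y ++ 1F ∷ d →
            ∃[ t ] 1F ∷ d ≡ t ++ 0F ∷ 0F ∷ []
ends00-++ r y eq with levi r y eq
... | inj₁ (t , _ , e₂) = t , e₂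
... | inj₂ ([] , _ , ())
... | inj₂ (_ ∷ [] , _ , ())
... | inj₂ (_ ∷ _ ∷ [] , _ , ())
... | inj₂ (_ ∷ _ ∷ _ ∷ _ , _ , ())

EndsIn00 : Word → Set
EndsIn00 w = ∃[ r ] w ≡ r ++ 0F ∷ 0F ∷ []

endsIn00-++ : ∀ u {v} → EndsIn00 v → EndsIn00 (u ++ v)
endsIn00-++ u (r , refl) = u ++ r , sym (++-assoc u r _)

¬10∧00 : ∀ p → ¬ EndsIn00 (p ++ 1F ∷ 0F ∷ [])
¬10∧00 p (r , eq) with ∷ʳ-injective (p ∷ʳ 1F) (r ∷ʳ 0F)
  (trans (++-assoc p _ _) (trans eq (sym (++-assoc r _ _))))
... | eq′ , _ with () ← proj₂ (∷ʳ-injective p r eq′)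

-- A block ends with 0, and at least one more 0 is put after it.
move-last-endsIn00 : ∀ a {x} k i → IsBlock x → 1 ≤ i → EndsIn00 (a ++ 0^ k ++ x ++ 0^ i ++ [])
move-last-endsIn00 a {x} k (suc i) X _ with y , refl ← block-last X =
  endsIn00-++ a (endsIn00-++ (0^ k) (subst EndsIn00 (sym (++-assoc y (0F ∷ []) _)) (endsIn00-++ y (00s i))))
  where
  00s : ∀ i → EndsIn00 (0F ∷ 0F ∷ 0^ i ++ [])
  00s zero    = [] , refl
  00s (suc i) with r , eq ← 00s i = 0F ∷ r , cong (0F ∷_) eq

-- A move of a last block creates the ending `00` afresh; any other move leaves a suffix starting
-- with 1 untouched, and the old ending lies in it.
endsIn00-step : ∀ {u v} → u ⇝ v → EndsIn00 u → EndsIn00 v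
endsIn00-step (move a {N = N} {i} X (inj₁ refl) M 1≤i i≤N) _ = move-last-endsIn00 a (N ∸ i) i X 1≤i
endsIn00-step (move a {x} {N = N} {i} X (inj₂ (d , refl)) M 1≤i i≤N) (r , eq) =
  endsIn00-++ a (endsIn00-++ (0^ (N ∸ i)) (endsIn00-++ x (endsIn00-++ (0^ i)
    (ends00-++ r (a ++ 0^ N ++ x) (trans (sym eq) (sym (++-assoc₃ a (0^ N) x _)))))))

endsIn00-steps : ∀ {u v} → u ⇝* v → EndsIn00 u → EndsIn00 v
endsIn00-steps ε        E = E
endsIn00-steps (m ◅ ms) E = endsIn00-steps ms (endsIn00-step m E)

cancel10-step : ∀ {p u v} → u ⇝ v → u ≡ p ++ 1F ∷ 0F ∷ [] →
                EndsIn00 v ⊎ ∃[ p′ ] v ≡ p′ ++ 1F ∷ 0F ∷ [] × p ⇝ p′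
cancel10-step (move a {N = N} {i} X (inj₁ refl) M 1≤i i≤N) _ =
  inj₁ (move-last-endsIn00 a (N ∸ i) i X 1≤i)
cancel10-step {p} (move a {x} {N = N} {i} X (inj₂ (d , refl)) M 1≤i i≤N) eq
  with ends10-++ p (a ++ 0^ N ++ x) (trans (sym eq) (sym (++-assoc₃ a (0^ N) x _)))
... | t , e₁ , refl = inj₂ (a ++ 0^ (N ∸ i) ++ x ++ 0^ i ++ t
  , trans (cong (λ z → a ++ 0^ (N ∸ i) ++ x ++ 0^ i ++ z) e₁)
      (sym (++-assoc₅ a (0^ (N ∸ i)) x (0^ i) t _))
  , subst (_⇝ a ++ 0^ (N ∸ i) ++ x ++ 0^ i ++ t) (sym (++-assoc₃ a (0^ N) x _))
      (move a X (follows t e₁) M 1≤i i≤N))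
  where
  follows : ∀ t → 1F ∷ d ≡ t ++ 1F ∷ 0F ∷ [] → Follows t
  -- If `b` is exactly the final `10`, then `x` becomes the end of the shortened word and is movable
  -- for that reason.
  follows []       _    = inj₁ refl
  follows (_ ∷ t)  refl = inj₂ (t , refl)

cancel10 : ∀ {p q u} → u ⇝* q ++ 1F ∷ 0F ∷ [] → u ≡ p ++ 1F ∷ 0F ∷ [] → p ⇝* q
cancel10 {p} {q} {u} ms eq = go ms eq refl
  where
  go : ∀ {p u v} → u ⇝* v → u ≡ p ++ 1F ∷ 0F ∷ [] → v ≡ q ++ 1F ∷ 0F ∷ [] → p ⇝* q
  go {p} ε refl eq with refl ← ++-cancelʳ _ p q eq = ε
  go (m ◅ ms) eq eq′ with cancel10-step m eq
  -- The ending `00` would persist up to the last word, which ends in `10`.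
  ... | inj₁ E = contradiction (subst EndsIn00 eq′ (endsIn00-steps ms E)) (¬10∧00 q)
  ... | inj₂ (p′ , e₁ , n) = n ◅ go ms e₁ eq′

-- The edges that climb to the maximum of a core interval

trailing0s : ∀ y → ∃[ a ] ∃[ k ] y ≡ a ++ 0^ k × NoTrailing0 a
trailing0s [] = [] , 0 , refl , λ { [] () ; (_ ∷ _) () }
trailing0s (c ∷ y) with trailing0s y
... | a@(_ ∷ _) , k , eq , M = c ∷ a , k , cong (c ∷_) eq , noTrailing0-extend (c ∷ []) (λ ()) M
trailing0s (0F ∷ y) | [] , k , eq , M = [] , suc k , cong (0F ∷_) eq , M
trailing0s (1F ∷ y) | [] , k , eq , M = 1F ∷ [] , k , cong (1F ∷_) eq ,
  λ { [] () ; (_ ∷ []) () ; (_ ∷ _ ∷ _) () }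

-- The displayed 0 is the last letter of a maximal run, whose other zeros are split off `y`; the
-- move has i = 1.
⇝-swap : ∀ y {x b} → IsBlock x → Follows b → y ++ 0F ∷ x ++ b ⇝ y ++ x ++ 0F ∷ b
⇝-swap y {x} {b} X F with trailing0s y
... | a , k , refl , M = subst₂ _⇝_
  (trans (cong (a ++_) (sym (0^-∷ʳ k (x ++ b)))) (sym (++-assoc a (0^ k) (0F ∷ x ++ b))))
  (sym (++-assoc a (0^ k) (x ++ 0F ∷ b)))
  (move a {x} {b} {suc k} X F M (s≤s z≤n) (s≤s z≤n))

blocks-follow : ∀ {bs d} → All IsBlock bs → Follows (concat bs ++ 1F ∷ d)
blocks-follow []       = inj₂ (_ , refl)
blocks-follow (B ∷ Bs) with y , refl ← block-head B = inj₂ (_ , refl)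

-- The single 0 passes the blocks one by one from left to right, and finally the block `10`.
⇝*-absorb : ∀ a {bs} → All IsBlock bs →
            a ++ 0F ∷ concat bs ++ 1F ∷ 0F ∷ [] ⇝* a ++ concat bs ++ 1F ∷ 0F ∷ 0F ∷ []
⇝*-absorb a [] = ⇝-swap a 10-isBlock (inj₁ refl) ◅ ε
⇝*-absorb a {b ∷ bs} (B ∷ Bs) =
  subst₂ _⇝_ (cong (λ z → a ++ 0F ∷ z) (sym (++-assoc b (concat bs) _))) (sym (++-assoc a b _))
    (⇝-swap a B (blocks-follow Bs))
  ◅ subst ((a ++ b) ++ 0F ∷ concat bs ++ 1F ∷ 0F ∷ [] ⇝*_)
      (trans (++-assoc a b _) (cong (a ++_) (sym (++-assoc b (concat bs) _))))
      (⇝*-absorb (a ++ b) Bs)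

top : Word → Word
top w = 1F ∷ w ++ 1F ∷ 0F ∷ 0F ∷ []

⇝-top : ∀ {u v} → u ⇝ v → top u ⇝ top v
⇝-top (move a {x} {b} {N} {i} X F M 1≤i i≤N) = subst₂ _⇝_
  (cong (1F ∷_) (sym (++-assoc₄ a (0^ N) x b _)))
  (cong (1F ∷_) (sym (++-assoc₅ a (0^ (N ∸ i)) x (0^ i) b _)))
  (move (1F ∷ a) X (follows F) (noTrailing0 a M) 1≤i i≤N)
  where
  follows : ∀ {b} → Follows b → Follows (b ++ 1F ∷ 0F ∷ 0F ∷ [])
  -- A block at the end of the word is now followed by the 1 of the added ending.
  follows (inj₁ refl)       = inj₂ (_ , refl)
  follows (inj₂ (_ , refl)) = inj₂ (_ , refl)
  noTrailing0 : ∀ a → NoTrailing0 a → NoTrailing0 (1F ∷ a)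
  noTrailing0 []        M = λ { [] () ; (_ ∷ []) () ; (_ ∷ _ ∷ _) () }
  noTrailing0 (_ ∷ _) M = noTrailing0-extend (1F ∷ []) (λ ()) M

-- The words eᵢ(w)

take-drop-blocks : ∀ i w → concat (take i (blocks w)) ++ concat (drop i (blocks w)) ≡ w
take-drop-blocks i w = begin
  concat (take i bs) ++ concat (drop i bs) ≡⟨ concat-++ (take i bs) (drop i bs) ⟩
  concat (take i bs ++ drop i bs)          ≡⟨ cong concat (take++drop≡id i bs) ⟩
  concat bs                                ≡⟨ concat-blocks w ⟩
  w                                        ∎
  where
  open ≡-Reasoning
  bs = blocks w

e⇝*top : ∀ {n} i {w} → IsDyck n w → e i w ⇝* top w
e⇝*top i {w} D = subst (e i w ⇝*_)
  (cong (1F ∷_) (trans (sym (++-assoc (concat (take i (blocks w))) (concat (drop i (blocks w))) _))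
    (cong (_++ 1F ∷ 0F ∷ 0F ∷ []) (take-drop-blocks i w))))
  (⇝*-absorb (1F ∷ concat (take i (blocks w))) (All.drop⁺ i (blocks-isBlock D)))

-- The exponent serves both endings: `10` for k = 0 and `100` for k = 1.
ones-10 : ∀ w k → ones (w ++ 1F ∷ 0F ∷ 0^ k) ≡ suc (ones w)
ones-10 []       k = cong suc (trans (cong ones (sym (++-identityʳ (0^ k)))) (ones-0^ k []))
ones-10 (0F ∷ w) k = ones-10 w k
ones-10 (1F ∷ w) k = cong suc (ones-10 w k)

ones-top : ∀ w → ones (top w) ≡ 2 + ones w
ones-top w = cong suc (ones-10 w 1)

ones-e : ∀ i w → ones (e i w) ≡ 2 + ones w
ones-e i w = cong suc (begin
  ones (u ++ 0F ∷ v ++ 1F ∷ 0F ∷ [])   ≡⟨ ones-++ u _ ⟩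
  ones u + ones (v ++ 1F ∷ 0F ∷ [])    ≡⟨ cong (_+_ (ones u)) (ones-10 v 0) ⟩
  ones u + suc (ones v)                ≡⟨ +-suc (ones u) (ones v) ⟩
  suc (ones u + ones v)                ≡⟨ cong suc (ones-++ u v) ⟨
  suc (ones (u ++ v))                  ≡⟨ cong (suc ∘ ones) (take-drop-blocks i w) ⟩
  suc (ones w)                         ∎)
  where
  open ≡-Reasoning
  u = concat (take i (blocks w))
  v = concat (drop i (blocks w))

e-path : ∀ {n} i {w} → IsDyck n w →
         ∃[ v ] Path 0 v × e i w ≡ v ++ 1F ∷ 0F ∷ []
e-path i {w} D =
  1F ∷ u ++ 0F ∷ v
  , up (path-++ (blocks-path (All.take⁺ i Bs)) (down (blocks-path (All.drop⁺ i Bs))))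
  , sym (++-assoc (1F ∷ u) (0F ∷ v) _)
  where
  Bs = blocks-isBlock D
  u = concat (take i (blocks w))
  v = concat (drop i (blocks w))

path-of-size : ∀ {n w} → Path 0 w → ones w ≡ n → IsDyck n w
path-of-size p refl = path⇒isDyck p

e-isDyck : ∀ {n} i {w} → IsDyck n w → IsDyck (2 + n) (e i w)
e-isDyck i {w} D with e-path i D
... | v , p , eq = path-of-size (subst (Path 0) (sym eq) (path-++ p (up (down []))))
  (trans (ones-e i w) (cong (suc ∘ suc) (IsDyck.ones≡n D)))

top-isDyck : ∀ {n w} → IsDyck n w → IsDyck (2 + n) (top w)
top-isDyck {w = w} D = path-of-size (up (path-++ (isDyck⇒path D) (up (down (down [])))))
  (trans (ones-top w) (cong (suc ∘ suc) (IsDyck.ones≡n D)))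

blocks-++ : ∀ {u v} → Path 0 u → Path 0 v → blocks (u ++ v) ≡ blocks u ++ blocks v
blocks-++ {u} {v} p q = trans
  (cong blocks (trans (sym (cong₂ _++_ (concat-blocks u) (concat-blocks v))) (concat-++ (blocks u) (blocks v))))
  (blocks-unique (All.++⁺ (blocks-isBlock (path⇒isDyck p)) (blocks-isBlock (path⇒isDyck q))))

take-length-++ : ∀ {A : Set} (xs ys : List A) → take (length xs) (xs ++ ys) ≡ xs
take-length-++ []       ys = refl
take-length-++ (x ∷ xs) ys = cong (x ∷_) (take-length-++ xs ys)

drop-length-++ : ∀ {A : Set} (xs ys : List A) → drop (length xs) (xs ++ ys) ≡ ys
drop-length-++ []       ys = refl
drop-length-++ (x ∷ xs) ys = drop-length-++ xs ys

-- Read backwards, this recovers the index from a word of the given shape: it is the number of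
-- blocks before the first return.
e-numBlocks : ∀ {u v} → Path 0 u → Path 0 v →
              e (numBlocks u) (u ++ v) ≡ 1F ∷ u ++ 0F ∷ v ++ 1F ∷ 0F ∷ []
e-numBlocks {u} {v} p q
  rewrite blocks-++ p q | take-length-++ (blocks u) (blocks v) | drop-length-++ (blocks u) (blocks v)
        | concat-blocks u | concat-blocks v = refl

-- The inserted 0 is the first return of the word, which therefore determines the blocks taken and
-- the blocks dropped. The bounds on i and j make each index the number of blocks taken.
e-injective : ∀ {m n i j u v} → IsDyck m u → IsDyck n v → i ≤ numBlocks u → j ≤ numBlocks v →
              e i u ≡ e j v → u ≡ v × i ≡ j
e-injective {i = i} {j} {u} {v} U V i≤ j≤ eq = u≡v , i≡j
  where
  us = blocks-isBlock U
  vs = blocks-isBlock V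
  parts = first-return-unique (blocks-path (All.take⁺ i us)) (blocks-path (All.take⁺ j vs))
    (∷-injectiveʳ eq)
  takes : take i (blocks u) ≡ take j (blocks v)
  takes = trans (sym (blocks-unique (All.take⁺ i us)))
    (trans (cong blocks (proj₁ parts)) (blocks-unique (All.take⁺ j vs)))
  u≡v : u ≡ v
  u≡v = trans (sym (take-drop-blocks i u)) (trans
    (cong₂ _++_ (proj₁ parts) (++-cancelʳ _ (concat (drop i (blocks u))) _ (proj₂ parts)))
    (take-drop-blocks j v))
  length-prefix : ∀ {k w} → k ≤ numBlocks w → length (take k (blocks w)) ≡ k
  length-prefix {k} {w} k≤ = trans (length-take k (blocks w)) (m≤n⇒m⊓n≡m k≤)
  i≡j : i ≡ j
  i≡j = trans (sym (length-prefix {w = u} i≤)) (trans (cong length takes) (length-prefix {w = v} j≤))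

-- The heart of surjectivity: writing `v` as (1, A, 0, B), the interval below is found with minimum
-- (A, B) and index the number of blocks of A.
core⇒e : ∀ {k v w} → Path 0 v → Path 0 w → ones v ≡ suc k → v ++ 1F ∷ 0F ∷ [] ⇝* top w →
         ∃[ u ] Path 0 u × (∃[ i ] i ≤ numBlocks u × e i u ≡ v ++ 1F ∷ 0F ∷ []) × u ⇝* w
core⇒e {w = w} (up p) PW _ ms with path-first-return p
... | A , B , refl , PA , PB
  with removed-steps PA (path-++ PB (up (down []))) (cong (1F ∷_) (++-assoc A (0F ∷ B) _)) ms
...   | A′ , B′ , eq , PA′ , PB′ , ns
  -- The first return of `top w` is its last letter, so what is left after the removal is `w`
  -- followed by `10`, with an empty second part.
  with first-return-unique (path-++ PW (up (down []))) PA′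
         (trans (++-assoc w (1F ∷ 0F ∷ []) (0F ∷ [])) (∷-injectiveʳ eq))
...     | refl , refl =
  A ++ B , path-++ PA PB
  , (numBlocks A , subst (numBlocks A ≤_)
        (sym (trans (cong length (blocks-++ PA PB)) (length-++ (blocks A)))) (m≤m+n _ _)
    , trans (e-numBlocks PA PB) (sym (++-assoc (1F ∷ A) (0F ∷ B) _)))
  , cancel10 (subst (A ++ B ++ 1F ∷ 0F ∷ [] ⇝*_) (++-identityʳ _) ns) (sym (++-assoc A B _))

-- The bijection

eᴰ : ∀ {n} → ℕ → DyckPath n → DyckPath (2 + n)
eᴰ i w = mkDyckPath (e i (word w)) (e-isDyck i (isDyck w))

topᴰ : ∀ {n} → DyckPath n → DyckPath (2 + n)
topᴰ w = mkDyckPath (top (word w)) (top-isDyck (isDyck w))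

coreInterval : ∀ {n} → IndexedInterval n → Σ (Interval (2 + n)) IsCore
coreInterval (I , i) =
  record
    { min     = eᴰ (toℕ i) (min I)
    ; max     = topᴰ (max I)
    -- The path passes through `top` of the smaller minimum and then follows the given interval
    -- under `top`.
    ; min≼max = ⇝*⇒≼ (e⇝*top (toℕ i) D ◅◅ gmap top ⇝-top (≼⇒⇝* (Interval.min≼max I)))
    }
  , record
    { minShape = let v , p , eq = e-path (toℕ i) D in v , (_ , path⇒isDyck p) , eq
    ; maxShape = word (max I) , (_ , isDyck (max I)) , refl
    }
  where
  D = isDyck (min I)

coreInterval-injective : ∀ {n} (x y : IndexedInterval n) →
  endpoints (proj₁ (coreInterval x)) ≡ endpoints (proj₁ (coreInterval y)) →
  (endpoints (proj₁ x) , toℕ (proj₂ x)) ≡ (endpoints (proj₁ y) , toℕ (proj₂ y))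
coreInterval-injective (I , i) (J , j) eq
  with e-injective (isDyck (min I)) (isDyck (min J)) (toℕ≤pred[n] i) (toℕ≤pred[n] j)
         (cong (word ∘ proj₁) eq)
... | min≡ , i≡j = cong₂ _,_ (cong₂ _,_ (word-injective min≡) (word-injective max≡)) i≡j
  where
  max≡ : word (max I) ≡ word (max J)
  max≡ = ++-cancelʳ _ (word (max I)) (word (max J)) (∷-injectiveʳ (cong (word ∘ proj₂) eq))

coreInterval-surjective : ∀ {n} (J : Interval (2 + n)) → IsCore J →
  ∃[ x ] endpoints (proj₁ (coreInterval x)) ≡ endpoints J
coreInterval-surjective {n} J C
  with v , (_ , V) , min≡ ← IsCore.minShape C
     | w , (_ , W) , max≡ ← IsCore.maxShape C
  with ones-min ← trans (cong ones (sym min≡)) (IsDyck.ones≡n (isDyck (min J)))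
     | ones-max ← trans (cong ones (sym max≡)) (IsDyck.ones≡n (isDyck (max J)))
  with u , U , (i , i≤ , e≡) , ms ← core⇒e (isDyck⇒path V) (isDyck⇒path W)
         -- The minimum has n + 2 letters 1, so `v` has n + 1 of them and is not empty.
         (suc-injective (trans (sym (ones-10 v 0)) ones-min))
         (subst₂ _⇝*_ min≡ max≡ (≼⇒⇝* (Interval.min≼max J)))
  = ( record
        { min     = mkDyckPath u (path-of-size U
            (size (trans (sym (ones-e i u)) (trans (cong ones e≡) ones-min))))
        ; max     = mkDyckPath w (path-of-size (isDyck⇒path W) (size (trans (sym (ones-top w)) ones-max)))
        ; min≼max = ⇝*⇒≼ ms
        }
    , fromℕ< (s≤s i≤))
  , cong₂ _,_
      (word-injective (trans (cong (λ k → e k u) (toℕ-fromℕ< (s≤s i≤))) (trans e≡ (sym min≡))))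
      (word-injective (sym max≡))
  where
  size : ∀ {k} → suc (suc k) ≡ suc (suc n) → k ≡ n
  size = suc-injective ∘ suc-injective

mainTheorem8 : (n : ℕ) → 2 ≤ n →
    Σ (Bijection (IndexedIntervals (n ∸ 2)) (CoreIntervals n)) λ f →
    (I : Interval (n ∸ 2)) (i : Fin (suc (numBlocks (word (min I))))) →
    let J = proj₁ (Bijection.to f (I , i)) in
    word (min J) ≡ e (toℕ i) (word (min I)) ×
    word (max J) ≡ 1F ∷ word (max I) ++ 1F ∷ 0F ∷ 0F ∷ []
mainTheorem8 (suc (suc n)) (s≤s (s≤s z≤n)) = bijection , λ I i → refl , refl
  where
  bijection : Bijection (IndexedIntervals n) (CoreIntervals (2 + n))
  bijection = record
    { to        = coreInterval
    ; cong      = λ {x} {y} → congruent x y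
    ; bijective = (λ {x} {y} → coreInterval-injective x y)
                , λ (J , C) → let x , eq = coreInterval-surjective J C in
                    x , λ {z} z≈x → trans (congruent z x z≈x) eq
    }
    where
    congruent : ∀ (x y : IndexedInterval n) →
      (endpoints (proj₁ x) , toℕ (proj₂ x)) ≡ (endpoints (proj₁ y) , toℕ (proj₂ y)) →
      endpoints (proj₁ (coreInterval x)) ≡ endpoints (proj₁ (coreInterval y))
    -- The endpoints of the image are a function of the endpoints and the index alone.
    congruent _ _ = cong λ { ((u , v) , k) → eᴰ k u , topᴰ v }
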